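{- For every integer $n\geq 1$, the algorithm $\mathrm{EnumBP}$ (described in the context) on input $n$ enumerates $\mathsf{BP}_n$: identifying each output with the partitioned order it represents, every element of $\mathsf{BP}_n$ is output exactly once and nothing else is output.
   Context: Notation: $\llbracket n\rrbracket=\{0,\dots,n-1\}$. A partitioned order of $\llbracket n\rrbracket$ is an (unordered) set $\{S_k\}_{k\in\llbracket s\rrbracket}$ of $s$ non-empty finite sequences, each consisting of pairwise distinct elements of $\llbracket n\rrbracket$, the sequences being pairwise disjoint (as sets of entries) with union $\llbracket n\rrbracket$; so every element of $\llbracket n\rrbracket$ occurs at exactly one position of exactly one sequence. The sequences are called o-blocks. $\mathsf{BP}_n$ is the set of all partitioned orders of $\llbracket n\rrbracket$ (block-parallel update modes of size $n$). Integer partitions: $p(n)$ is the number of integer partitions of $n$, listed in some fixed order as partitions number $1,\dots,p(n)$; $d(i)$ is the maximal part size of the $i$-th partition, and $m(i,j)$ is the multiplicity of the part of size $j$ in it (possibly $0$). Matrix representation: a list $M=(M_1,\dots,M_{d(i)})$, where $M_j$ is a matrix with $m(i,j)$ rows and $j$ columns (empty if $m(i,j)=0$) such that each element of $\llbracket n\rrbracket$ is an entry exactly once overall, represents the partitioned order whose o-blocks are all the rows of all the matrices (each row read from left to right). Algorithm $\mathrm{EnumBP}(n)$: for each $i$ from $1$ to $p(n)$, call $\mathrm{Aux}(n,i,1)$. $\mathrm{Aux}(n,i,j,M_1,\dots,M_{j-1})$: (1) If $d(i)<j$, output $M=(M_1,\dots,M_{j-1})$ and return. (2) Otherwise, if $m(i,j)>0$: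 for each subset $A$ of size $j\cdot m(i,j)$ of the elements of $\llbracket n\rrbracket$ not occurring in $M_1,\dots,M_{j-1}$, and for each subset $C\subseteq A$ of size $m(i,j)$: sort $C$ increasingly as $C[1]<\dots<C[m(i,j)]$ and set $M_j[k][1]=C[k]$ for $1\le k\le m(i,j)$; then for each ordering (permutation) $B$ of $A\setminus C$, set $M_j[k][\ell]=B[(k-1)(j-1)+\ell-1]$ for $1\le k\le m(i,j)$, $2\le\ell\le j$ (with $B$ indexed from $1$), and call $\mathrm{Aux}(n,i,j+1,M_1,\dots,M_{j-1},M_j)$. (3) Otherwise ($m(i,j)=0$), call $\mathrm{Aux}(n,i,j+1,M_1,\dots,M_{j-1},\emptyset)$. -}

module Defs where

open import Data.Bool.Base using (true; false)
import Data.Bool.Properties as Bool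
open import Data.Fin.Base using (Fin; zero; suc; combine)
import Data.Fin.Properties as Fin
open import Data.Fin.Subset using (Subset; inside; outside; _⊆_; ∣_∣; _─_; ∁; ⋃; ⁅_⁆)
  renaming (_∈_ to _∈ₛ_)
import Data.Fin.Subset.Properties as Subset
open import Data.Irrelevant using ([_])
open import Data.List.Base using (List; []; _∷_; _++_; map; concat; concatMap; cartesianProductWith; deduplicate; filter; length; lookup; upTo; allFin)
open import Data.List.Extrema.Nat using (max)
open import Data.List.Membership.Propositional using (_∈_)
import Data.List.Membership.Propositional.Properties as ∈
import Data.List.Properties as List
open import Data.List.Relation.Binary.BagAndSetEquality using (_∼[_]_; set)
open import Data.List.Relation.Binary.Disjoint.Propositional using (Disjoint)
open import Data.List.Relation.Unary.All using (All; []; _∷_; all?)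
open import Data.List.Relation.Unary.AllPairs using (AllPairs)
open import Data.List.Relation.Unary.Any using (here; there)
open import Data.List.Relation.Unary.Linked using (Linked; linked?)
open import Data.List.Relation.Unary.Unique.Propositional using (Unique)
import Data.List.Relation.Unary.Unique.DecPropositional.Properties as Unique
open import Data.Nat.Base using (ℕ; zero; suc; _*_; _∸_; _≤_; _<_; _≥_; _>_; z≤n; s≤s)
open import Data.Nat.Induction using (<-wellFounded)
open import Data.Nat.ListAction using (sum)
open import Data.Nat.Properties using (_≟_; _<?_; _≤?_; ≮⇒≥; ≤-refl; ≤-reflexive; ≤-trans; ∸-monoʳ-<; m≤m+n; m≤n+m)
open import Data.Product using (∃; ∃!; _×_; _,_; proj₂)
open import Data.Refinement using (Refinement-syntax; value; value-injective)
  renaming (_,_ to _⊢_)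
open import Data.Vec.Base as Vec using (Vec; []; _∷_; tabulate)
import Data.Vec.Membership.DecPropositional as DecVec
open import Data.Vec.Membership.Propositional using () renaming (_∈_ to _∈ᵥ_)
import Data.Vec.Properties as Vec
import Data.Vec.Relation.Unary.AllPairs as VecAllPairs
open import Data.Vec.Relation.Unary.Unique.Propositional using () renaming (Unique to Uniqueᵥ)
open import Function.Bundles using (_⇔_; mk⇔; Equivalence)
open import Induction.WellFounded using (Acc; acc)
open import Relation.Binary.Definitions using (DecidableEquality)
open import Relation.Binary.PropositionalEquality using (_≡_; _≢_; refl; cong)
open import Relation.Nullary using (Dec; yes; no; ¬?; recompute; contradiction-irr)
open import Relation.Nullary.Decidable using (map′; _×-dec_; _→-dec_)
open import Relation.Unary using (Decidable)

private
  variable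
    A : Set
    n : ℕ

OccursOnce : (A → Set) → List A → Set
OccursOnce P xs = ∃! _≡_ λ (i : Fin (length xs)) → P (lookup xs i)

-- The o-blocks are pairwise disjoint and non-empty, hence distinct, so
-- the list has no repetition; it stands for the set of its members, and
-- two lists are only ever compared through _∼[ set ]_.

record BP (n : ℕ) : Set where
  field
    blocks   : List (List (Fin n))
    nonEmpty : All (_≢ []) blocks
    distinct : All Unique blocks
    disjoint : AllPairs Disjoint blocks
    covering : ∀ x → ∃ λ b → b ∈ blocks × x ∈ b

IsPartition : ℕ → List ℕ → Set
IsPartition n ps = sum ps ≡ n × All (_> 0) ps × Linked _≥_ ps

Partition : ℕ → Set
Partition n = [ ps ∈ List ℕ ∣ IsPartition n ps ]

maxPart : Partition n → ℕ
maxPart p = max 0 (value p)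

multiplicity : Partition n → ℕ → ℕ
multiplicity p j = length (filter (_≟ j) (value p))

Matrix : Set → ℕ → ℕ → Set
Matrix A m j = Vec (Vec A j) m

infixl 5 _▷_

-- Matrices p k is the type of lists M₁, …, Mₖ in which Mⱼ has
-- multiplicity p j rows and j columns.

data Matrices (p : Partition n) : ℕ → Set where
  []  : Matrices p 0
  _▷_ : ∀ {k} → Matrices p k →
        Matrix (Fin n) (multiplicity p (suc k)) (suc k) → Matrices p (suc k)

rows : ∀ {p : Partition n} {k} → Matrices p k → List (List (Fin n))
rows []        = []
rows (Ms ▷ M) = rows Ms ++ map Vec.toList (Vec.toList M)

entries : ∀ {p : Partition n} {k} → Matrices p k → List (Fin n)
entries Ms = concat (rows Ms)

record Output (n : ℕ) : Set where
  constructor output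
  field
    {partition} : Partition n
    {size}      : ℕ
    matrices    : Matrices partition size

infix 4 _Represents_

record _Represents_ (M : Output n) (P : BP n) : Set where
  open Output M
  field
    fullSize   : size ≡ maxPart partition
    entryOnce  : ∀ x → OccursOnce (_≡ x) (entries matrices)
    sameBlocks : rows matrices ∼[ set ] BP.blocks P

SubsetOf : Subset n → ℕ → Set
SubsetOf {n} X k = [ S ∈ Subset n ∣ S ⊆ X × ∣ S ∣ ≡ k ]

-- Inhabited only when k is the size of X.

Ordering : Subset n → ℕ → Set
Ordering {n} X k = [ B ∈ Vec (Fin n) k ∣ Uniqueᵥ B × (∀ x → x ∈ᵥ B ⇔ x ∈ₛ X) ]

record Enumeration (A : Set) : Set where
  field
    list     : List A
    unique   : Unique list
    complete : ∀ x → x ∈ list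

open Enumeration using (list)

-- The algorithm leaves open in which order its loops run through
-- partitions, subsets and permutations.

record LoopOrders (n : ℕ) : Set where
  field
    partitions : Enumeration (Partition n)
    subsets    : ∀ (X : Subset n) k → Enumeration (SubsetOf X k)
    orderings  : ∀ (X : Subset n) k → Enumeration (Ordering X k)

-- In increasing order, which is what sorting C asks for.

elements : (S : Subset n) → Vec (Fin n) ∣ S ∣
elements []            = []
elements (inside  ∷ S) = zero ∷ Vec.map suc (elements S)
elements (outside ∷ S) = Vec.map suc (elements S)

sort : ∀ {X : Subset n} {k} → SubsetOf X k → Vec (Fin n) k
sort (S ⊢ [ pf ]) = Vec.cast (proj₂ pf) (elements S)

-- First column C; the remaining ℓ columns are filled row by row from B,
-- since combine k i is the index k * ℓ + i.

fill : ∀ {m ℓ} → Vec A m → Vec A (m * ℓ) → Matrix A m (suc ℓ)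
fill C B = tabulate λ k → Vec.lookup C k ∷ tabulate λ i → Vec.lookup B (combine k i)

remaining : ∀ {p : Partition n} {k} → Matrices p k → Subset n
remaining Ms = ∁ (⋃ (map ⁅_⁆ (entries Ms)))

module _ (loops : LoopOrders n) where
  open LoopOrders loops

  -- The values successively given to M_j, with j = suc ℓ and m = m(i,j),
  -- when X is the set of elements not yet used; m = 0 gives only ∅.

  candidates : Subset n → (m ℓ : ℕ) → List (Matrix (Fin n) m (suc ℓ))
  candidates X zero      ℓ = [] ∷ []
  candidates X m@(suc _) ℓ =
    concatMap (λ S →
      concatMap (λ C →
        map (λ B → fill (sort C) (value B))
          (list (orderings (value S ─ value C) (m * ℓ))))
        (list (subsets (value S) m)))
      (list (subsets X (suc ℓ * m)))

  -- aux p (M₁, …, Mₖ) is the recursive call for column count j = suc k;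
  -- the Acc argument only serves termination.

  aux : ∀ (p : Partition n) {k} → Matrices p k →
        Acc _<_ (suc (maxPart p) ∸ suc k) → List (Output n)
  aux p {k} Ms (acc rec) with maxPart p <? suc k
  ... | yes d<j = output Ms ∷ []
  ... | no  d≮j =
    concatMap (λ M → aux p (Ms ▷ M) (rec (∸-monoʳ-< ≤-refl (≮⇒≥ d≮j))))
      (candidates (remaining Ms) (multiplicity p (suc k)) k)

  EnumBP : List (Output n)
  EnumBP = concatMap (λ p → aux p [] (<-wellFounded _)) (list partitions)

-- Loop orders exist, so the quantification over them is not vacuous: see
-- loopOrders below.

enumerate : {P : A → Set} → DecidableEquality A → Decidable P →
            (xs : List A) → (∀ x → P x → x ∈ xs) → Enumeration [ x ∈ A ∣ P x ]
enumerate {A} {P} _≟ᴬ_ P? xs cover = record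
  { list     = deduplicate _≟ᴿ_ (select xs)
  ; unique   = Unique.deduplicate-! _≟ᴿ_ (select xs)
  ; complete = λ { r@(x ⊢ [ px ]) →
      ∈.∈-deduplicate⁺ _≟ᴿ_ (∈-select r (cover x (recompute (P? x) px))) }
  }
  where
  _≟ᴿ_ : DecidableEquality [ x ∈ A ∣ P x ]
  r ≟ᴿ s = map′ value-injective (cong value) (value r ≟ᴬ value s)

  select : List A → List [ x ∈ A ∣ P x ]
  select []       = []
  select (x ∷ xs) with P? x
  ... | yes px = (x ⊢ [ px ]) ∷ select xs
  ... | no  _  = select xs

  ∈-select : ∀ {xs} r → value r ∈ xs → r ∈ select xs
  ∈-select {x ∷ xs} (_ ⊢ [ px ]) (here refl) with P? x
  ... | yes _  = here refl
  ... | no ¬px = contradiction-irr px ¬px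
  ∈-select {x ∷ xs} r (there r∈xs) with P? x
  ... | yes _ = there (∈-select r r∈xs)
  ... | no  _ = ∈-select r r∈xs

vectors : List A → ∀ k → List (Vec A k)
vectors xs zero    = [] ∷ []
vectors xs (suc k) = cartesianProductWith _∷_ xs (vectors xs k)

∈-vectors : {xs : List A} → (∀ x → x ∈ xs) → ∀ {k} (v : Vec A k) → v ∈ vectors xs k
∈-vectors all []      = here refl
∈-vectors all (x ∷ v) = ∈.∈-cartesianProductWith⁺ _∷_ (all x) (∈-vectors all v)

boundedLists : ℕ → ℕ → List (List ℕ)
boundedLists n zero    = [] ∷ []
boundedLists n (suc l) =
  [] ∷ cartesianProductWith _∷_ (upTo (suc n)) (boundedLists n l)

∈-boundedLists : ∀ n l {ps} → All (_> 0) ps → sum ps ≤ n → sum ps ≤ l → ps ∈ boundedLists n l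
∈-boundedLists n zero    []            _   _   = here refl
∈-boundedLists n zero    (s≤s z≤n ∷ _) _   ()
∈-boundedLists n (suc l) []            _   _   = here refl
∈-boundedLists n (suc l) {suc q ∷ ps} (s≤s z≤n ∷ pos) s≤n (s≤s s≤l) =
  there (∈.∈-cartesianProductWith⁺ _∷_
    (∈.∈-upTo⁺ (s≤s (≤-trans (m≤m+n (suc q) (sum ps)) s≤n)))
    (∈-boundedLists n l pos (≤-trans (m≤n+m (sum ps) (suc q)) s≤n)
                            (≤-trans (m≤n+m (sum ps) q) s≤l)))

loopOrders : ∀ n → LoopOrders n
loopOrders n = record
  { partitions = enumerate (List.≡-dec _≟_)
      (λ ps → sum ps ≟ n ×-dec all? (0 <?_) ps ×-dec linked? (λ a b → b ≤? a) ps)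
      (boundedLists n n)
      (λ { ps (s≡n , pos , _) → ∈-boundedLists n n pos (≤-reflexive s≡n) (≤-reflexive s≡n) })
  ; subsets = λ X k → enumerate (Vec.≡-dec Bool._≟_)
      (λ S → S Subset.⊆? X ×-dec ∣ S ∣ ≟ k)
      (vectors (true ∷ false ∷ []) n)
      (λ S _ → ∈-vectors (λ { true → here refl ; false → there (here refl) }) S)
  ; orderings = λ X k → enumerate (Vec.≡-dec Fin._≟_)
      (λ B → VecAllPairs.allPairs? (λ x y → ¬? (x Fin.≟ y)) B
             ×-dec Fin.all? (λ x → (x ∈ᵥ? B) ⇔-dec (x Subset.∈? X)))
      (vectors (allFin n) k)
      (λ B _ → ∈-vectors ∈.∈-allFin B)
  }
  where
  open DecVec Fin._≟_ using () renaming (_∈?_ to _∈ᵥ?_)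

  _⇔-dec_ : {P Q : Set} → Dec P → Dec Q → Dec (P ⇔ Q)
  P? ⇔-dec Q? = map′ (λ { (f , g) → mk⇔ f g })
                     (λ e → Equivalence.to e , Equivalence.from e)
                     ((P? →-dec Q?) ×-dec (Q? →-dec P?))

module Submission where

-- Call an output valid if its matrices have pairwise disjoint entries
-- without repetition and every first column is increasing.  All outputs
-- of the algorithm are valid.  Conversely, each valid output is produced
-- once, because it determines every loop choice: A is the set of entries
-- of M_j, C the set of entries of its first column, and B the remaining
-- entries row by row.  A partitioned order is represented by exactly one
-- valid output: its block lengths determine the integer partition, and
-- since distinct blocks of length j have distinct heads, exactly one
-- arrangement of them as the rows of M_j makes the first column increasing.

open import Defs
open import Data.Bool.Base using (true; false)
open import Data.Empty using (⊥-elim)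
open import Data.Fin.Base as Fin using (Fin; zero; suc; combine)
import Data.Fin.Properties as Fin
open import Data.Fin.Subset using (Subset; inside; outside; _⊆_; ∣_∣; _─_; ⋃; ⁅_⁆)
  renaming (_∈_ to _∈ₛ_; _∉_ to _∉ₛ_)
import Data.Fin.Subset.Properties as Subset
open import Data.Irrelevant using ([_])
open import Data.List.Base using (List; []; _∷_; _++_; map; concat; concatMap; filter; length; replicate)
open import Data.List.Extrema.Nat using (xs≤max)
import Data.List.Membership.DecPropositional as DecList
open import Data.List.Membership.Propositional using (_∈_; find)
import Data.List.Membership.Propositional.Properties as ∈
open import Data.List.Membership.Propositional.Properties.WithK using (unique∧set⇒bag)
import Data.List.Properties as List
open import Data.List.Relation.Binary.BagAndSetEquality using (_∼[_]_; set; ∼bag⇒↭)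
open import Data.List.Relation.Binary.Disjoint.Propositional using (Disjoint)
open import Data.List.Relation.Binary.Permutation.Propositional as ↭
  using (_↭_; ↭-refl; ↭-sym; ↭-trans; ↭-reflexive; ↭⇒↭ₛ; module PermutationReasoning)
import Data.List.Relation.Binary.Permutation.Propositional.Properties as ↭
import Data.List.Relation.Binary.Permutation.Setoid.Properties as ↭ₛ
open import Data.List.Relation.Binary.Pointwise using (Pointwise-≡⇒≡)
open import Data.List.Relation.Unary.All as All using (All; []; _∷_)
import Data.List.Relation.Unary.All.Properties as All
open import Data.List.Relation.Unary.AllPairs as AllPairs using (AllPairs; []; _∷_)
import Data.List.Relation.Unary.AllPairs.Properties as AllPairs
open import Data.List.Relation.Unary.Any using (here; there)
open import Data.List.Relation.Unary.Linked using (Linked; linked?)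
open import Data.List.Relation.Unary.Linked.Properties using (Linked⇒AllPairs)
open import Data.List.Relation.Unary.Sorted.TotalOrder.Properties using (↗↭↗⇒≋)
open import Data.List.Relation.Unary.Unique.Propositional using (Unique)
import Data.List.Relation.Unary.Unique.Propositional.Properties as Unique
import Data.List.Sort
open import Data.Nat.Base
  using (ℕ; zero; suc; _+_; _*_; _≤_; _<_; _≥_; _>_; z≤n; s≤s; z<s; s<s; s≤s⁻¹)
open import Data.Nat.Induction using (<-wellFounded)
open import Data.Nat.ListAction using (sum)
open import Data.Nat.ListAction.Properties using (sum-↭)
open import Data.Nat.Properties
  using (_≟_; _≤?_; _<?_; ≤-refl; ≤-reflexive; ≤-trans; ≤-antisym; ≤-decTotalOrder; <⇒≤; <⇒≢; <⇒≱;
         ≤⇒≯; ≮⇒≥; ≤∧≢⇒<; m≤n⇒m≤1+n; 1+n≰n; ∸-monoʳ-<; *-comm)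
open import Data.Product using (∃; _×_; _,_; proj₁; proj₂)
open import Data.Refinement using (value; value-injective) renaming (_,_ to _⊢_)
open import Data.Sum using (inj₁; inj₂; [_,_]′)
open import Data.Unit using (⊤; tt)
open import Data.Vec.Base as Vec using (Vec; []; _∷_)
import Data.Vec.Membership.Propositional.Properties as ∈ᵥ
import Data.Vec.Properties as Vec
import Data.Vec.Relation.Unary.All.Properties as VecAll
import Data.Vec.Relation.Unary.AllPairs as VecAllPairs
open import Data.Vec.Relation.Unary.Unique.Propositional using () renaming (Unique to Uniqueᵥ)
open import Function.Base using (_∘_; id)
open import Function.Bundles using (_⇔_; mk⇔; Equivalence)
open import Induction.WellFounded using (acc)
open import Level using (0ℓ)
open import Relation.Binary.Bundles using (DecTotalOrder)
import Relation.Binary.Construct.Flip.EqAndOrd as Flip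
import Relation.Binary.Construct.On as On
open import Relation.Binary.Core using (Rel)
open import Relation.Binary.Definitions using (Asymmetric)
open import Relation.Binary.PropositionalEquality
  using (_≡_; _≢_; refl; sym; trans; cong; cong₂; subst; subst₂; setoid; ≢-sym; module ≡-Reasoning)
open import Relation.Nullary using (¬_; ¬?; does; yes; no; contradiction; recompute)
open import Relation.Nullary.Decidable using (_×-dec_)
open import Relation.Unary using (Decidable)

private
  variable
    A B : Set
    P Q : A → Set
    n : ℕ

-- Predicates satisfied at exactly one position of a list

-- An inductive form of `OccursOnce`: nested loops can be unfolded by recursion on lists, without
-- arithmetic on positions.
data Once (P : A → Set) : List A → Set where
  here  : ∀ {x xs} → P x → All (¬_ ∘ P) xs → Once P (x ∷ xs)
  there : ∀ {x xs} → ¬ P x → Once P xs → Once P (x ∷ xs)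

once⇒occursOnce : ∀ {xs} → Once P xs → OccursOnce P xs
once⇒occursOnce (here px ¬pxs) = zero , px , λ
  { {zero}  _  → refl
  ; {suc j} pj → contradiction pj (All.lookup ¬pxs (∈.∈-lookup j)) }
once⇒occursOnce (there ¬px pxs) with once⇒occursOnce pxs
... | i , pi , i! = suc i , pi , λ
  { {zero}  px → contradiction px ¬px
  ; {suc j} pj → cong suc (i! pj) }

-- The equivalence is asked only of members of the list. In the theorem, being equal to one fixed
-- valid output and representing `P` agree on the outputs of the algorithm but not on arbitrary
-- matrices, whose rows may be permuted.
once-resp-⇔ : ∀ {xs} → All (λ x → P x ⇔ Q x) xs → Once P xs → Once Q xs
once-resp-⇔ (p⇔q ∷ ps⇔qs) (here px ¬pxs) =
  here (Equivalence.to p⇔q px)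
       (All.zipWith (λ { (p⇔q , ¬p) → ¬p ∘ Equivalence.from p⇔q }) (ps⇔qs , ¬pxs))
once-resp-⇔ (p⇔q ∷ ps⇔qs) (there ¬px pxs) =
  there (¬px ∘ Equivalence.from p⇔q) (once-resp-⇔ ps⇔qs pxs)

unique⇒once : ∀ {x : A} {xs} → Unique xs → x ∈ xs → Once (_≡ x) xs
unique⇒once (x∉xs ∷ xs!) (here refl)  = here refl (All.map ≢-sym x∉xs)
unique⇒once (y∉xs ∷ xs!) (there x∈xs) = there (All.lookup y∉xs x∈xs) (unique⇒once xs! x∈xs)

once-++⁺ˡ : ∀ {xs ys} → Once P xs → All (¬_ ∘ P) ys → Once P (xs ++ ys)
once-++⁺ˡ (here px ¬pxs)  ¬pys = here px (All.++⁺ ¬pxs ¬pys)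
once-++⁺ˡ (there ¬px pxs) ¬pys = there ¬px (once-++⁺ˡ pxs ¬pys)

once-++⁺ʳ : ∀ {xs ys} → All (¬_ ∘ P) xs → Once P ys → Once P (xs ++ ys)
once-++⁺ʳ []           pys = pys
once-++⁺ʳ (¬px ∷ ¬pxs) pys = there ¬px (once-++⁺ʳ ¬pxs pys)

-- One layer of a nested loop: `Q` singles out the right loop index, the results at that index
-- satisfy `P` once, and a result satisfying `P` can come from no other index.
once-concatMap⁺ : ∀ {f : A → List B} {xs} → Once Q xs →
                  (∀ {x} → Q x → Once P (f x)) →
                  (∀ {x y} → x ∈ xs → y ∈ f x → P y → Q x) →
                  Once P (concatMap f xs)
once-concatMap⁺ (here qx ¬qxs) once only = once-++⁺ˡ (once qx)
  (All.concat⁺ (All.map⁺ (All.tabulate λ y∈ →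
    All.tabulate λ z∈ pz → All.lookup ¬qxs y∈ (only (there y∈) z∈ pz))))
once-concatMap⁺ (there ¬qx qxs) once only =
  once-++⁺ʳ (All.tabulate λ z∈ pz → ¬qx (only (here refl) z∈ pz))
            (once-concatMap⁺ qxs once (only ∘ there))

once-map⁺ : ∀ {f : A → B} {xs} → Once Q xs → (∀ {x} → Q x ⇔ P (f x)) → Once P (map f xs)
once-map⁺ (here qx ¬qxs)  q⇔p =
  here (Equivalence.to q⇔p qx) (All.map⁺ (All.map (_∘ Equivalence.from q⇔p) ¬qxs))
once-map⁺ (there ¬qx qxs) q⇔p = there (¬qx ∘ Equivalence.from q⇔p) (once-map⁺ qxs q⇔p)

once-enumeration : (e : Enumeration A) (x : A) → Once (_≡ x) (Enumeration.list e)
once-enumeration e x = unique⇒once (Enumeration.unique e) (Enumeration.complete e x)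

all-concatMap⁺ : ∀ {f : A → List B} xs → (∀ x → All P (f x)) → All P (concatMap f xs)
all-concatMap⁺ xs all = All.concat⁺ (All.map⁺ (All.universal all xs))

-- Lists

AllPairs-++⁻ : ∀ {R : Rel A 0ℓ} xs {ys} → AllPairs R (xs ++ ys) →
               AllPairs R xs × AllPairs R ys × All (λ x → All (R x) ys) xs
AllPairs-++⁻ []       rys = [] , rys , []
AllPairs-++⁻ (x ∷ xs) (rx ∷ rs) with AllPairs-++⁻ xs rs
... | rxs , rys , rxys = All.++⁻ˡ xs rx ∷ rxs , rys , All.++⁻ʳ xs rx ∷ rxys

unique-++⁻ : ∀ xs {ys : List A} → Unique (xs ++ ys) → Unique xs × Unique ys × Disjoint xs ys
unique-++⁻ xs xsys! with AllPairs-++⁻ xs xsys!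
... | xs! , ys! , xs≢ys =
  xs! , ys! , λ { (x∈xs , x∈ys) → All.lookup (All.lookup xs≢ys x∈xs) x∈ys refl }

unique-concat⁻ : ∀ (xss : List (List A)) → Unique (concat xss) →
                 All Unique xss × AllPairs Disjoint xss
unique-concat⁻ []         _   = [] , []
unique-concat⁻ (xs ∷ xss) xs! with unique-++⁻ xs xs!
... | xs! , xss! , disj with unique-concat⁻ xss xss!
... | all! , pairs = xs! ∷ all! ,
  All.tabulate (λ ys∈xss (v∈xs , v∈ys) → disj (v∈xs , ∈.∈-concat⁺′ v∈ys ys∈xss)) ∷ pairs

-- A block occurring twice would be disjoint from itself, hence empty.
disjoint⇒unique : ∀ {xss : List (List A)} → All (_≢ []) xss → AllPairs Disjoint xss → Unique xss
disjoint⇒unique []         []         = []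
disjoint⇒unique (≢[] ∷ ne) (d ∷ disj) =
  All.map (λ { dis refl → ≢[] (self-disjoint dis) }) d ∷ disjoint⇒unique ne disj
  where
  self-disjoint : ∀ {xs : List A} → Disjoint xs xs → xs ≡ []
  self-disjoint {xs = []}     _   = refl
  self-disjoint {xs = x ∷ xs} dis = ⊥-elim (dis (here refl , here refl))

unique-resp-↭ : ∀ {xs ys : List A} → xs ↭ ys → Unique xs → Unique ys
unique-resp-↭ xs↭ys = ↭ₛ.Unique-resp-↭ (setoid _) (↭⇒↭ₛ xs↭ys)

unique∧set⇒↭ : ∀ {xs ys : List A} → Unique xs → Unique ys → xs ∼[ set ] ys → xs ↭ ys
unique∧set⇒↭ xs! ys! eq = ∼bag⇒↭ (unique∧set⇒bag xs! ys! eq)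

↭⇒set : ∀ {xs ys : List A} → xs ↭ ys → xs ∼[ set ] ys
↭⇒set xs↭ys = mk⇔ (↭.∈-resp-↭ xs↭ys) (↭.∈-resp-↭ (↭-sym xs↭ys))

concat-↭ : ∀ {xss yss : List (List A)} → xss ↭ yss → concat xss ↭ concat yss
concat-↭ ↭.refl          = ↭-refl
concat-↭ (↭.prep xs p)   = ↭.++⁺ˡ xs (concat-↭ p)
concat-↭ (↭.swap xs ys p) =
  ↭-trans (↭.++⁺ˡ xs (↭.++⁺ˡ ys (concat-↭ p))) (↭.shifts xs ys)
concat-↭ (↭.trans p q)   = ↭-trans (concat-↭ p) (concat-↭ q)

-- If the heads differed, each would lie in the tail of the other list, so `_≺_` would hold between
-- them both ways. Applied to elements under `<` and to rows compared by their first entries.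
increasing∧set⇒≡ : ∀ {_≺_ : Rel A 0ℓ} → Asymmetric _≺_ → ∀ {xs ys} →
                   AllPairs _≺_ xs → AllPairs _≺_ ys → xs ∼[ set ] ys → xs ≡ ys
increasing∧set⇒≡ asym [] [] eq = refl
increasing∧set⇒≡ asym [] (_ ∷ _) eq with () ← Equivalence.from eq (here refl)
increasing∧set⇒≡ asym (_ ∷ _) [] eq with () ← Equivalence.to eq (here refl)
increasing∧set⇒≡ {_≺_ = _≺_} asym {x ∷ xs} {y ∷ ys} (x≺xs ∷ xs↗) (y≺ys ∷ ys↗) eq
  with heads
  where
  heads : x ≡ y
  heads with Equivalence.to eq (here refl) | Equivalence.from eq (here refl)
  ... | here x≡y   | _          = x≡y
  ... | there _    | here y≡x   = sym y≡x
  ... | there x∈ys | there y∈xs = contradiction (All.lookup x≺xs y∈xs) (asym (All.lookup y≺ys x∈ys))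
... | refl = cong (x ∷_) (increasing∧set⇒≡ asym xs↗ ys↗
    (mk⇔ (drop x≺xs (Equivalence.to eq ∘ there)) (drop y≺ys (Equivalence.from eq ∘ there))))
  where
  drop : ∀ {zs ws z} → All (x ≺_) zs → (z ∈ zs → z ∈ x ∷ ws) → z ∈ zs → z ∈ ws
  drop x≺zs f z∈zs with f z∈zs
  ... | there z∈ws = z∈ws
  -- Here `z` is `x` itself, and asymmetry rules out `x ≺ x`.
  ... | here refl  = contradiction (All.lookup x≺zs z∈zs) (asym (All.lookup x≺zs z∈zs))

-- Finite sets

fromList : List (Fin n) → Subset n
fromList xs = ⋃ (map ⁅_⁆ xs)

∈-fromList⁺ : ∀ {x : Fin n} {xs} → x ∈ xs → x ∈ₛ fromList xs
∈-fromList⁺ {xs = y ∷ xs} (here refl)  = Subset.p⊆p∪q _ (Subset.x∈⁅x⁆ y)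
∈-fromList⁺ {xs = y ∷ xs} (there x∈xs) = Subset.q⊆p∪q ⁅ y ⁆ _ (∈-fromList⁺ x∈xs)

∈-fromList⁻ : ∀ {x : Fin n} xs → x ∈ₛ fromList xs → x ∈ xs
∈-fromList⁻ []       x∈ = contradiction x∈ Subset.∉⊥
∈-fromList⁻ (y ∷ xs) x∈ with Subset.x∈p∪q⁻ ⁅ y ⁆ _ x∈
... | inj₁ x∈⁅y⁆ = here (Subset.x∈⁅y⁆⇒x≡y y x∈⁅y⁆)
... | inj₂ x∈xs  = there (∈-fromList⁻ xs x∈xs)

fromList-unique : ∀ {S : Subset n} xs → (∀ {x} → x ∈ₛ S ⇔ x ∈ xs) → S ≡ fromList xs
fromList-unique xs eq = Subset.⊆-antisym (∈-fromList⁺ ∘ Equivalence.to eq)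
                                         (Equivalence.from eq ∘ ∈-fromList⁻ xs)

∈-─⁻ : ∀ {x : Fin n} (S T : Subset n) → x ∈ₛ S ─ T → x ∈ₛ S × x ∉ₛ T
∈-─⁻ S T x∈ = Subset.p─q⊆p S T x∈ , notIn S T x∈
  where
  notIn : ∀ {n} {x : Fin n} (S T : Subset n) → x ∈ₛ S ─ T → x ∉ₛ T
  notIn (inside  ∷ S) (inside ∷ T) () Vec.here
  notIn (outside ∷ S) (inside ∷ T) () Vec.here
  notIn (_ ∷ S) (outside ∷ T) (Vec.there x∈) (Vec.there x∈T) = notIn S T x∈ x∈T
  notIn (_ ∷ S) (inside  ∷ T) (Vec.there x∈) (Vec.there x∈T) = notIn S T x∈ x∈T

elements-increasing : (S : Subset n) → AllPairs Fin._<_ (Vec.toList (elements S))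
elements-increasing []           = []
elements-increasing (inside ∷ S)
  rewrite Vec.toList-map Fin.suc (elements S)
  = All.map⁺ (All.universal (λ _ → z<s) _)
  ∷ AllPairs.map⁺ (AllPairs.map s<s (elements-increasing S))
elements-increasing (outside ∷ S)
  rewrite Vec.toList-map Fin.suc (elements S)
  = AllPairs.map⁺ (AllPairs.map s<s (elements-increasing S))

∈-elements⁺ : ∀ {S : Subset n} {x} → x ∈ₛ S → x ∈ Vec.toList (elements S)
∈-elements⁺ {S = inside ∷ S} Vec.here = here refl
∈-elements⁺ {S = inside ∷ S} (Vec.there x∈)
  rewrite Vec.toList-map Fin.suc (elements S) = there (∈.∈-map⁺ suc (∈-elements⁺ x∈))
∈-elements⁺ {S = outside ∷ S} (Vec.there x∈)
  rewrite Vec.toList-map Fin.suc (elements S) = ∈.∈-map⁺ suc (∈-elements⁺ x∈)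

∈-elements⁻ : ∀ (S : Subset n) {x} → x ∈ Vec.toList (elements S) → x ∈ₛ S
∈-elements⁻ (inside ∷ S) (here refl) = Vec.here
∈-elements⁻ (inside ∷ S) (there x∈)
  rewrite Vec.toList-map Fin.suc (elements S)
  with _ , y∈ , refl ← ∈.∈-map⁻ suc x∈ = Vec.there (∈-elements⁻ S y∈)
∈-elements⁻ (outside ∷ S) x∈
  rewrite Vec.toList-map Fin.suc (elements S)
  with _ , y∈ , refl ← ∈.∈-map⁻ suc x∈ = Vec.there (∈-elements⁻ S y∈)

increasing⇒unique : ∀ {xs : List (Fin n)} → AllPairs Fin._<_ xs → Unique xs
increasing⇒unique = AllPairs.map Fin.<⇒≢

-- The list `xs` and the increasing list of elements of `fromList xs` are both free of repetition
-- and have the same members, so they are permutations of each other.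
∣fromList∣ : ∀ {xs : List (Fin n)} → Unique xs → ∣ fromList xs ∣ ≡ length xs
∣fromList∣ {xs = xs} xs! = trans (sym (Vec.length-toList (elements (fromList xs))))
  (↭.↭-length (unique∧set⇒↭ (increasing⇒unique (elements-increasing (fromList xs))) xs!
    (mk⇔ (∈-fromList⁻ xs ∘ ∈-elements⁻ _) (∈-elements⁺ ∘ ∈-fromList⁺))))

toList-sort : ∀ {X : Subset n} {k} (S : SubsetOf X k) →
              Vec.toList (sort S) ≡ Vec.toList (elements (value S))
toList-sort (S ⊢ [ pf ]) = Vec.toList-cast (proj₂ pf) (elements S)

sort-increasing : ∀ {X : Subset n} {k} (S : SubsetOf X k) → AllPairs Fin._<_ (Vec.toList (sort S))
sort-increasing S rewrite toList-sort S = elements-increasing (value S)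

∈-sort : ∀ {X : Subset n} {k} (S : SubsetOf X k) {x} → x ∈ₛ value S ⇔ x ∈ Vec.toList (sort S)
∈-sort S rewrite toList-sort S = mk⇔ ∈-elements⁺ (∈-elements⁻ (value S))

-- Matrices

toList-injective : ∀ {k} {xs ys : Vec A k} → Vec.toList xs ≡ Vec.toList ys → xs ≡ ys
toList-injective {xs = xs} {ys} eq = trans (sym (Vec.cast-is-id refl xs)) (Vec.toList-injective refl xs ys eq)

matrixRows : ∀ {m j} → Matrix A m j → List (List A)
matrixRows M = map Vec.toList (Vec.toList M)

cells : ∀ {m j} → Matrix A m j → List A
cells M = concat (matrixRows M)

heads : ∀ {m ℓ} → Matrix A m (suc ℓ) → Vec A m
heads = Vec.map Vec.head

tails : ∀ {m ℓ} → Matrix A m (suc ℓ) → Vec A (m * ℓ)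
tails M = Vec.concat (Vec.map Vec.tail M)

length-cells : ∀ {m j} (M : Matrix A m j) → length (cells M) ≡ m * j
length-cells []      = refl
length-cells (r ∷ M) = trans (List.length-++ (Vec.toList r)) (cong₂ _+_ (Vec.length-toList r) (length-cells M))

-- The counterpart in `M` of splitting the set A into C and the rest. Reading row by row interleaves
-- the two pieces, hence only a permutation.
cells-↭ : ∀ {m ℓ} (M : Matrix A m (suc ℓ)) → cells M ↭ Vec.toList (heads M) ++ Vec.toList (tails M)
cells-↭ []            = ↭-refl
cells-↭ ((x ∷ r) ∷ M) = ↭.prep x (begin
  Vec.toList r ++ cells M
    ↭⟨ ↭.++⁺ˡ (Vec.toList r) (cells-↭ M) ⟩
  Vec.toList r ++ Vec.toList (heads M) ++ Vec.toList (tails M)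
    ↭⟨ ↭.shifts (Vec.toList r) (Vec.toList (heads M)) ⟩
  Vec.toList (heads M) ++ Vec.toList r ++ Vec.toList (tails M)
    ≡⟨ cong (Vec.toList (heads M) ++_) (Vec.toList-++ r (tails M)) ⟨
  Vec.toList (heads M) ++ Vec.toList (r Vec.++ tails M) ∎)
  where open PermutationReasoning

-- By computation, `combine` sends row zero to the first `ℓ` indices and shifts later rows by `ℓ`,
-- so `r` fills the first row and `B` the others.
fill-∷ : ∀ {m ℓ} (c : A) (C : Vec A m) (r : Vec A ℓ) (B : Vec A (m * ℓ)) →
         fill (c ∷ C) (r Vec.++ B) ≡ (c ∷ r) ∷ fill C B
fill-∷ c C r B = cong₂ (λ r M → (c ∷ r) ∷ M)
  (trans (Vec.tabulate-cong (Vec.lookup-++ˡ r B)) (Vec.tabulate∘lookup r))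
  (Vec.tabulate-cong λ k → cong (Vec.lookup C k ∷_)
    (Vec.tabulate-cong λ i → Vec.lookup-++ʳ r B (combine k i)))

-- With `heads-fill` and `tails-fill` this makes `fill` a bijection between pairs of vectors and
-- matrices, so a matrix determines its first column and its filling order.
fill-heads-tails : ∀ {m ℓ} (M : Matrix A m (suc ℓ)) → fill (heads M) (tails M) ≡ M
fill-heads-tails []            = refl
fill-heads-tails ((x ∷ r) ∷ M) =
  trans (fill-∷ x (heads M) r (tails M)) (cong ((x ∷ r) ∷_) (fill-heads-tails M))

heads-fill : ∀ {m ℓ} (C : Vec A m) (B : Vec A (m * ℓ)) → heads (fill C B) ≡ C
heads-fill C B = trans (sym (Vec.tabulate-∘ Vec.head _)) (Vec.tabulate∘lookup C)

tails-fill : ∀ {m ℓ} (C : Vec A m) (B : Vec A (m * ℓ)) → tails (fill C B) ≡ B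
tails-fill {m = zero} [] [] = refl
tails-fill {m = suc m} {ℓ} (c ∷ C) B with Vec.splitAt ℓ B
... | r , B′ , refl = trans (cong tails (fill-∷ c C r B′)) (cong (r Vec.++_) (tails-fill C B′))

-- Valid matrices and the loops of a single call

Unique⇒Uniqueᵥ : ∀ {k} (xs : Vec A k) → Unique (Vec.toList xs) → Uniqueᵥ xs
Unique⇒Uniqueᵥ []       []           = VecAllPairs.[]
Unique⇒Uniqueᵥ (x ∷ xs) (x∉xs ∷ xs!) = VecAll.toList⁻ x∉xs VecAllPairs.∷ Unique⇒Uniqueᵥ xs xs!

Uniqueᵥ⇒Unique : ∀ {k} {xs : Vec A k} → Uniqueᵥ xs → Unique (Vec.toList xs)
Uniqueᵥ⇒Unique VecAllPairs.[]             = []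
Uniqueᵥ⇒Unique (x∉xs VecAllPairs.∷ xs!) = VecAll.toList⁺ x∉xs ∷ Uniqueᵥ⇒Unique xs!

-- These conditions characterise the members of `candidates X m ℓ`: see `candidates-valid` and
-- `once-candidates`.
record ValidMatrix (X : Subset n) {m ℓ} (M : Matrix (Fin n) m (suc ℓ)) : Set where
  field
    unique     : Unique (cells M)
    available  : ∀ {x} → x ∈ cells M → x ∈ₛ X
    increasing : AllPairs Fin._<_ (Vec.toList (heads M))

-- The proof stored in a refinement is irrelevant. Since the property is decidable, `recompute`
-- gives a usable proof; the same device serves orderings and partitions below.
subset⊆ : ∀ {X : Subset n} {k} (S : SubsetOf X k) → value S ⊆ X
subset⊆ (S ⊢ [ pf ]) = recompute (_ Subset.⊆? _) (proj₁ pf)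

ordering-unique : ∀ {X : Subset n} {k} (B : Ordering X k) → Unique (Vec.toList (value B))
ordering-unique (B ⊢ [ pf ]) =
  Uniqueᵥ⇒Unique (recompute (VecAllPairs.allPairs? (λ x y → ¬? (x Fin.≟ y)) B) (proj₁ pf))

∈-ordering : ∀ {X : Subset n} {k} (B : Ordering X k) {x} → x ∈ Vec.toList (value B) ⇔ x ∈ₛ X
∈-ordering (B ⊢ [ pf ]) = mk⇔
  (λ x∈B → recompute (_ Subset.∈? _) (Equivalence.to (proj₂ pf _) (∈ᵥ.∈-toList⁻ x∈B)))
  (λ x∈X → recompute (_ ∈? _) (∈ᵥ.∈-toList⁺ (Equivalence.from (proj₂ pf _) x∈X)))
  where open DecList Fin._≟_ using (_∈?_)

module _ {X : Subset n} {m ℓ} (S : SubsetOf X (suc ℓ * m)) (C : SubsetOf (value S) m)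
         (B : Ordering (value S ─ value C) (m * ℓ)) where

  private
    M : Matrix (Fin n) m (suc ℓ)
    M = fill (sort C) (value B)

    C∪B : cells M ↭ Vec.toList (sort C) ++ Vec.toList (value B)
    C∪B = subst₂ (λ c b → cells M ↭ Vec.toList c ++ Vec.toList b)
      (heads-fill (sort C) (value B)) (tails-fill (sort C) (value B)) (cells-↭ M)

    disjoint : Disjoint (Vec.toList (sort C)) (Vec.toList (value B))
    disjoint (x∈C , x∈B) = proj₂ (∈-─⁻ (value S) (value C) (Equivalence.to (∈-ordering B) x∈B)) (Equivalence.from (∈-sort C) x∈C)

  -- The cells are a permutation of C followed by an ordering of the rest of A, so A can be read off
  -- the matrix.
  fill-cells : ∀ {x} → x ∈ₛ value S ⇔ x ∈ cells M
  fill-cells {x} = mk⇔ (↭.∈-resp-↭ (↭-sym C∪B) ∘ to)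
                       ([ subset⊆ C ∘ Equivalence.from (∈-sort C) , Subset.p─q⊆p _ _ ∘ Equivalence.to (∈-ordering B) ]′
                        ∘ ∈.∈-++⁻ _ ∘ ↭.∈-resp-↭ C∪B)
    where
    to : x ∈ₛ value S → x ∈ Vec.toList (sort C) ++ Vec.toList (value B)
    to x∈S with x Subset.∈? value C
    ... | yes x∈C = ∈.∈-++⁺ˡ (Equivalence.to (∈-sort C) x∈C)
    ... | no  x∉C = ∈.∈-++⁺ʳ _ (Equivalence.from (∈-ordering B) (Subset.x∈p∧x∉q⇒x∈p─q x∈S x∉C))

  fill-heads : ∀ {x} → x ∈ₛ value C ⇔ x ∈ Vec.toList (heads M)
  fill-heads rewrite heads-fill (sort C) (value B) = ∈-sort C

  fill-valid : ValidMatrix X M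
  fill-valid = record
    { unique     = unique-resp-↭ (↭-sym C∪B)
        (Unique.++⁺ (increasing⇒unique (sort-increasing C)) (ordering-unique B) disjoint)
    ; available  = subset⊆ S ∘ Equivalence.from fill-cells
    ; increasing = subst (AllPairs Fin._<_ ∘ Vec.toList) (sym (heads-fill (sort C) (value B)))
        (sort-increasing C)
    }

module _ (loops : LoopOrders n) where
  open LoopOrders loops

  candidates-valid : ∀ X m ℓ → All (ValidMatrix X) (candidates loops X m ℓ)
  candidates-valid X zero      ℓ = record { unique = [] ; available = λ () ; increasing = [] } ∷ []
  candidates-valid X m@(suc _) ℓ =
    all-concatMap⁺ (Enumeration.list (subsets X (suc ℓ * m))) λ S →
      all-concatMap⁺ (Enumeration.list (subsets (value S) m)) λ C →
        All.map⁺ (All.universal (fill-valid S C) (Enumeration.list (orderings _ (m * ℓ))))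

  module _ {X m ℓ} {M : Matrix (Fin n) m (suc ℓ)} (valid : ValidMatrix X M) where
    open ValidMatrix valid

    private
      headsTails! : Unique (Vec.toList (heads M)) × Unique (Vec.toList (tails M))
                    × Disjoint (Vec.toList (heads M)) (Vec.toList (tails M))
      headsTails! = unique-++⁻ _ (unique-resp-↭ (cells-↭ M) unique)

      heads! : Unique (Vec.toList (heads M))
      heads! = proj₁ headsTails!

      S₀ : SubsetOf X (suc ℓ * m)
      S₀ = fromList (cells M) ⊢
        [ available ∘ ∈-fromList⁻ (cells M)
        , trans (∣fromList∣ unique) (trans (length-cells M) (*-comm m (suc ℓ))) ]

      C₀ : SubsetOf (value S₀) m
      C₀ = fromList (Vec.toList (heads M)) ⊢
        [ ∈-fromList⁺ ∘ ↭.∈-resp-↭ (↭-sym (cells-↭ M)) ∘ ∈.∈-++⁺ˡ ∘ ∈-fromList⁻ (Vec.toList (heads M))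
        , trans (∣fromList∣ heads!) (Vec.length-toList (heads M)) ]

      ∈-tails : ∀ {x} → x ∈ Vec.toList (tails M) ⇔ x ∈ₛ value S₀ ─ value C₀
      ∈-tails {x} = mk⇔
        (λ x∈ → Subset.x∈p∧x∉q⇒x∈p─q
          (∈-fromList⁺ (↭.∈-resp-↭ (↭-sym (cells-↭ M)) (∈.∈-++⁺ʳ _ x∈)))
          (λ x∈C → proj₂ (proj₂ headsTails!) (∈-fromList⁻ _ x∈C , x∈)))
        from
        where
        from : x ∈ₛ value S₀ ─ value C₀ → x ∈ Vec.toList (tails M)
        from x∈ with x∈S , x∉C ← ∈-─⁻ (value S₀) (value C₀) x∈
          with ∈.∈-++⁻ (Vec.toList (heads M)) (↭.∈-resp-↭ (cells-↭ M) (∈-fromList⁻ _ x∈S))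
        ... | inj₁ x∈heads = contradiction (∈-fromList⁺ x∈heads) x∉C
        ... | inj₂ x∈tails = x∈tails

      B₀ : Ordering (value S₀ ─ value C₀) (m * ℓ)
      B₀ = tails M ⊢
        [ Unique⇒Uniqueᵥ _ (proj₁ (proj₂ headsTails!))
        , (λ x → mk⇔ (Equivalence.to ∈-tails ∘ ∈ᵥ.∈-toList⁺)
                     (∈ᵥ.∈-toList⁻ ∘ Equivalence.from ∈-tails)) ]

      -- Two increasing lists with the same members are equal. Here validity enters through
      -- `increasing`: the loops only ever write sorted first columns.
      sort-C₀ : sort C₀ ≡ heads M
      sort-C₀ = toList-injective (increasing∧set⇒≡ Fin.<-asym (sort-increasing C₀) increasing
        (mk⇔ (∈-fromList⁻ _ ∘ Equivalence.from (∈-sort C₀)) (Equivalence.to (∈-sort C₀) ∘ ∈-fromList⁺)))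

      fill₀ : fill (sort C₀) (tails M) ≡ M
      fill₀ = trans (cong (λ C → fill C (tails M)) sort-C₀) (fill-heads-tails M)

      -- The types of C and B depend on the earlier choices, so the loops are settled from the
      -- outside in: first A, for arbitrary C and B, then C with A fixed to `S₀`, then B with both
      -- fixed.
      S-unique : ∀ (S : SubsetOf X (suc ℓ * m)) (C : SubsetOf (value S) m) B →
                 fill (sort C) (value B) ≡ M → S ≡ S₀
      S-unique S C B eq = value-injective (fromList-unique _
        (subst (λ N → ∀ {x} → x ∈ₛ value S ⇔ x ∈ cells N) eq (fill-cells S C B)))

      C-unique : ∀ (C : SubsetOf (value S₀) m) B → fill (sort C) (value B) ≡ M → C ≡ C₀
      C-unique C B eq = value-injective (fromList-unique _
        (subst (λ N → ∀ {x} → x ∈ₛ value C ⇔ x ∈ Vec.toList (heads N)) eq (fill-heads S₀ C B)))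

      B-unique : ∀ (B : Ordering (value S₀ ─ value C₀) (m * ℓ)) →
                 fill (sort C₀) (value B) ≡ M → B ≡ B₀
      B-unique B eq = value-injective (trans (sym (tails-fill (sort C₀) (value B))) (cong tails eq))

    -- The loops are written out for arbitrary `m`, because `candidates` unfolds to them only after
    -- a case split on `m`.
    once-loops : Once (_≡ M)
      (concatMap (λ S →
        concatMap (λ C →
          map (λ B → fill (sort C) (value B))
            (Enumeration.list (orderings (value S ─ value C) (m * ℓ))))
          (Enumeration.list (subsets (value S) m)))
        (Enumeration.list (subsets X (suc ℓ * m))))
    once-loops = once-concatMap⁺ (once-enumeration (subsets X _) S₀)
      (λ { refl → once-concatMap⁺ (once-enumeration (subsets (value S₀) m) C₀)
        (λ { refl → once-map⁺ (once-enumeration (orderings _ _) B₀)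
          (λ {B} → mk⇔ (λ { refl → fill₀ }) (B-unique B)) })
        (λ {C} _ N∈ N≡M → let B , _ , N≡ = ∈.∈-map⁻ _ N∈ in C-unique C B (trans (sym N≡) N≡M)) })
      (λ {S} _ N∈ N≡M →
        let C , _ , N∈C = find (∈.∈-concatMap⁻ _ {Enumeration.list (subsets (value S) m)} N∈)
            B , _ , N≡  = ∈.∈-map⁻ _ N∈C
        in S-unique S C B (trans (sym N≡) N≡M))

  once-candidates : ∀ {X} m {ℓ} {M : Matrix (Fin n) m (suc ℓ)} →
                    ValidMatrix X M → Once (_≡ M) (candidates loops X m ℓ)
  once-candidates zero    {M = []} _     = here refl []
  once-candidates (suc _)          valid = once-loops valid

-- Runs of the algorithm

Valid : ∀ {p : Partition n} {k} → Matrices p k → Set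
Valid []       = ⊤
Valid (Ms ▷ M) = Valid Ms × ValidMatrix (remaining Ms) M

infix 4 _⊑_

-- The relation of being an initial segment. It grows the shorter list, following the recursion of
-- `aux`: `next` names the matrix that the current call has to choose in order to reach the longer
-- list.
data _⊑_ {p : Partition n} : ∀ {k l} → Matrices p k → Matrices p l → Set where
  done : ∀ {k} {Ms : Matrices p k} → Ms ⊑ Ms
  next : ∀ {k l} {Ms : Matrices p k} {M} {Ns : Matrices p l} → Ms ▷ M ⊑ Ns → Ms ⊑ Ns

module _ {p : Partition n} where

  ⊑⇒≤ : ∀ {k l} {Ms : Matrices p k} {Ns : Matrices p l} → Ms ⊑ Ns → k ≤ l
  ⊑⇒≤ done      = ≤-refl
  ⊑⇒≤ (next le) = <⇒≤ (⊑⇒≤ le)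

  -- Both segments have length `k`, so they are the same; unequal numbers of `next` steps would give
  -- `suc k ≤ k`.
  ⊑-functional : ∀ {k l} {Ms Ms′ : Matrices p k} {Ns : Matrices p l} → Ms ⊑ Ns → Ms′ ⊑ Ns → Ms ≡ Ms′
  ⊑-functional done     done      = refl
  ⊑-functional done     (next le) = contradiction (⊑⇒≤ le) 1+n≰n
  ⊑-functional (next le) done     = contradiction (⊑⇒≤ le) 1+n≰n
  ⊑-functional (next le) (next le′) with refl ← ⊑-functional le le′ = refl

  []⊑ : ∀ {l} (Ns : Matrices p l) → [] ⊑ Ns
  []⊑ Ns = reach Ns done
    where
    -- The argument `Ms` loses its last matrix at each call, while the proof records that what is
    -- left is still an initial segment of `Ns`.
    reach : ∀ {k} (Ms : Matrices p k) → Ms ⊑ Ns → [] ⊑ Ns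
    reach []       le = le
    reach (Ms ▷ M) le = reach Ms (next le)

  valid-⊑ : ∀ {k l} {Ms : Matrices p k} {Ns : Matrices p l} → Ms ⊑ Ns → Valid Ns → Valid Ms
  valid-⊑ done      valid = valid
  valid-⊑ (next le) valid = proj₁ (valid-⊑ le valid)

-- Indexed by the output, so that matching on `result` reveals the partition and the full size that
-- `Output` hides in its fields.
data Result {p : Partition n} {k} (Ms : Matrices p k) : Output n → Set where
  result : (Ns : Matrices p (maxPart p)) → Ms ⊑ Ns → Valid Ns → Result Ms (output Ns)

module _ (loops : LoopOrders n) where
  open LoopOrders loops

  aux-sound : ∀ p {k} (Ms : Matrices p k) ac → k ≤ maxPart p → Valid Ms →
              All (Result Ms) (aux loops p Ms ac)
  aux-sound p {k} Ms (acc rec) k≤d valid with maxPart p <? suc k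
  -- The bounds `k ≤ maxPart p` and `maxPart p < suc k` pin down `k`, so the result has full size.
  ... | yes d<j with refl ← ≤-antisym k≤d (s≤s⁻¹ d<j) = result Ms done valid ∷ []
  ... | no  d≮j = All.concat⁺ (All.map⁺ (All.map extend
    (candidates-valid loops (remaining Ms) (multiplicity p (suc k)) k)))
    where
    extend : ∀ {M} → ValidMatrix (remaining Ms) M →
             All (Result Ms) (aux loops p (Ms ▷ M) (rec (∸-monoʳ-< ≤-refl (≮⇒≥ d≮j))))
    extend validM = All.map (λ { (result Ns le validNs) → result Ns (next le) validNs })
      (aux-sound p _ (rec (∸-monoʳ-< ≤-refl (≮⇒≥ d≮j))) (≮⇒≥ d≮j) (valid , validM))

  -- Only the candidate `M₀` that continues `Ms` towards `Ns` can lead to `Ns`: by `aux-sound` all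
  -- outputs of a recursive call extend its argument, and initial segments of a given length are
  -- unique.
  once-aux : ∀ p {k} (Ms : Matrices p k) ac {Ns : Matrices p (maxPart p)} →
             Ms ⊑ Ns → Valid Ns → Once (_≡ output Ns) (aux loops p Ms ac)
  once-aux p {k} Ms (acc rec) le valid with maxPart p <? suc k | le
  ... | yes d<j | done    = here refl []
  -- The recursion stops exactly when `Ns` is reached: a matrix still missing would give
  -- `suc k ≤ maxPart p`, and `done` makes `k` equal to `maxPart p`.
  ... | yes d<j | next le = contradiction d<j (≤⇒≯ (⊑⇒≤ le))
  ... | no  d≮j | done    = contradiction ≤-refl d≮j
  ... | no  d≮j | next {M = M₀} le = once-concatMap⁺
    (once-candidates loops (multiplicity p (suc k)) (proj₂ validMs▷M₀))
    (λ { refl → once-aux p _ (rec (∸-monoʳ-< ≤-refl (≮⇒≥ d≮j))) le valid })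
    only
    where
    validMs▷M₀ = valid-⊑ le valid

    only : ∀ {M O} → M ∈ candidates loops (remaining Ms) (multiplicity p (suc k)) k →
           O ∈ aux loops p (Ms ▷ M) (rec (∸-monoʳ-< ≤-refl (≮⇒≥ d≮j))) → O ≡ output _ → M ≡ M₀
    only {M} M∈ O∈ O≡ with validM ← All.lookup (candidates-valid loops _ (multiplicity p (suc k)) k) M∈
      with All.lookup (aux-sound p (Ms ▷ M) (rec (∸-monoʳ-< ≤-refl (≮⇒≥ d≮j))) (≮⇒≥ d≮j) (proj₁ validMs▷M₀ , validM)) O∈ | O≡
    ... | result _ le′ _ | refl with refl ← ⊑-functional le le′ = refl

  EnumBP-sound : All (λ O → ∃ λ p → Result {p = p} [] O) (EnumBP loops)
  EnumBP-sound = all-concatMap⁺ (Enumeration.list partitions) λ p →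
    All.map (p ,_) (aux-sound p [] (<-wellFounded _) z≤n tt)

  -- An output carries its partition, so runs for different partitions share no output.
  once-EnumBP : ∀ {p} (Ns : Matrices p (maxPart p)) → Valid Ns → Once (_≡ output Ns) (EnumBP loops)
  once-EnumBP {p} Ns valid = once-concatMap⁺ (once-enumeration partitions p)
    (λ { refl → once-aux p [] (<-wellFounded _) ([]⊑ Ns) valid })
    (λ {q} _ O∈ O≡ → only (All.lookup (aux-sound q [] (<-wellFounded _) z≤n tt) O∈) O≡)
    where
    only : ∀ {q O} → Result {p = q} [] O → O ≡ output Ns → q ≡ p
    only (result _ _ _) refl = refl

-- Row lengths

length-concat : (xss : List (List A)) → length (concat xss) ≡ sum (map length xss)
length-concat []         = refl
length-concat (xs ∷ xss) = trans (List.length-++ xs) (cong (length xs +_) (length-concat xss))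

filter-map : ∀ {P : B → Set} (P? : Decidable P) (f : A → B) xs →
             filter P? (map f xs) ≡ map f (filter (P? ∘ f) xs)
filter-map P? f []       = refl
filter-map P? f (x ∷ xs) with does (P? (f x))
... | true  = cong (f x ∷_) (filter-map P? f xs)
... | false = filter-map P? f xs

filter-≟ : ∀ j xs → filter (_≟ j) xs ≡ replicate (length (filter (_≟ j) xs)) j
filter-≟ j xs = constant (All.all-filter (_≟ j) xs)
  where
  constant : ∀ {ys} → All (_≡ j) ys → ys ≡ replicate (length ys) j
  constant []         = refl
  constant (refl ∷ c) = cong (j ∷_) (constant c)

-- Passing from k to k + 1 adds the elements of value k + 1, moved behind the smaller ones. Used
-- with `id` on the parts of a partition and with `length` on the blocks of an order, to match the
-- appending of one matrix.
filter-≤-suc : (f : A → ℕ) (k : ℕ) (xs : List A) →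
  filter (λ x → f x ≤? suc k) xs ↭ filter (λ x → f x ≤? k) xs ++ filter (λ x → f x ≟ suc k) xs
filter-≤-suc f k [] = ↭-refl
filter-≤-suc f k (x ∷ xs) with f x ≤? k | f x ≟ suc k
... | yes fx≤k | _
  rewrite List.filter-accept (λ x → f x ≤? suc k) {x} {xs} (m≤n⇒m≤1+n fx≤k)
        | List.filter-accept (λ x → f x ≤? k) {x} {xs} fx≤k
        | List.filter-reject (λ x → f x ≟ suc k) {x} {xs} (<⇒≢ (s≤s fx≤k))
  = ↭.prep x (filter-≤-suc f k xs)
... | no fx≰k | yes fx≡1+k
  rewrite List.filter-accept (λ x → f x ≤? suc k) {x} {xs} (≤-reflexive fx≡1+k)
        | List.filter-reject (λ x → f x ≤? k) {x} {xs} fx≰k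
        | List.filter-accept (λ x → f x ≟ suc k) {x} {xs} fx≡1+k
  = ↭-trans (↭.prep x (filter-≤-suc f k xs)) (↭-sym (↭.shift x _ _))
... | no fx≰k | no fx≢1+k
  rewrite List.filter-reject (λ x → f x ≤? suc k) {x} {xs} (λ fx≤1+k → fx≰k (s≤s⁻¹ (≤∧≢⇒< fx≤1+k fx≢1+k)))
        | List.filter-reject (λ x → f x ≤? k) {x} {xs} fx≰k
        | List.filter-reject (λ x → f x ≟ suc k) {x} {xs} fx≢1+k
  = filter-≤-suc f k xs

isPartition : (p : Partition n) → IsPartition n (value p)
isPartition {n} (ps ⊢ [ pf ]) = recompute
  (sum ps ≟ n ×-dec All.all? (0 <?_) ps ×-dec linked? (λ a b → b ≤? a) ps) pf

-- In the reversed order, the condition `Linked _≥_` on partitions is ordinary sortedness.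
≥-decTotalOrder : DecTotalOrder 0ℓ 0ℓ 0ℓ
≥-decTotalOrder = Flip.decTotalOrder ≤-decTotalOrder

sorted-↭⇒≡ : ∀ {xs ys} → Linked _≥_ xs → Linked _≥_ ys → xs ↭ ys → xs ≡ ys
sorted-↭⇒≡ xs↘ ys↘ xs↭ys = Pointwise-≡⇒≡
  (↗↭↗⇒≋ (DecTotalOrder.totalOrder ≥-decTotalOrder) xs↘ ys↘ (↭⇒↭ₛ xs↭ys))

↭⇒≡-partition : {p q : Partition n} → value p ↭ value q → p ≡ q
↭⇒≡-partition {p = p} {q} p↭q = value-injective
  (sorted-↭⇒≡ (proj₂ (proj₂ (isPartition p))) (proj₂ (proj₂ (isPartition q))) p↭q)

matrixRows-length : ∀ {m j} (M : Matrix A m j) → All (λ r → length r ≡ j) (matrixRows M)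
matrixRows-length M = All.map⁺ (All.universal Vec.length-toList (Vec.toList M))

map-length-matrixRows : ∀ {m j} (M : Matrix A m j) → map length (matrixRows M) ≡ replicate m j
map-length-matrixRows []      = refl
map-length-matrixRows (r ∷ M) = cong₂ _∷_ (Vec.length-toList r) (map-length-matrixRows M)

module _ {p : Partition n} where

  rows-length : ∀ {k} (Ms : Matrices p k) → All (λ r → 0 < length r × length r ≤ k) (rows Ms)
  rows-length []       = []
  rows-length (Ms ▷ M) = All.++⁺
    (All.map (λ { (0< , ≤k) → 0< , m≤n⇒m≤1+n ≤k }) (rows-length Ms))
    (All.map (λ r≡1+k → ≤-trans z<s (≤-reflexive (sym r≡1+k)) , ≤-reflexive r≡1+k) (matrixRows-length M))

  rows-nonEmpty : ∀ {k} (Ms : Matrices p k) → All (_≢ []) (rows Ms)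
  rows-nonEmpty Ms = All.map (λ { (() , _) refl }) (rows-length Ms)

  -- Each new matrix contributes `multiplicity p (suc k)` rows of length `suc k`, one for each part
  -- of that size. At zero both sides are empty because parts are positive.
  map-length-rows : ∀ {k} (Ms : Matrices p k) → map length (rows Ms) ↭ filter (_≤? k) (value p)
  map-length-rows [] = ↭-reflexive (sym (List.filter-none (_≤? 0)
    (All.map <⇒≱ (proj₁ (proj₂ (isPartition p))))))
  map-length-rows {suc k} (Ms ▷ M) = begin
    map length (rows Ms ++ matrixRows M)
      ≡⟨ List.map-++ length (rows Ms) (matrixRows M) ⟩
    map length (rows Ms) ++ map length (matrixRows M)
      ≡⟨ cong (map length (rows Ms) ++_) (trans (map-length-matrixRows M) (sym (filter-≟ (suc k) (value p)))) ⟩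
    map length (rows Ms) ++ filter (_≟ suc k) (value p)
      ↭⟨ ↭.++⁺ʳ _ (map-length-rows Ms) ⟩
    filter (_≤? k) (value p) ++ filter (_≟ suc k) (value p)
      ↭⟨ filter-≤-suc id k (value p) ⟨
    filter (_≤? suc k) (value p) ∎
    where open PermutationReasoning

  map-length-rows-full : (Ms : Matrices p (maxPart p)) → map length (rows Ms) ↭ value p
  map-length-rows-full Ms = ↭-trans (map-length-rows Ms)
    (↭-reflexive (List.filter-all (_≤? maxPart p) (xs≤max 0 (value p))))

  -- The shapes alone force this count, as the row lengths are the parts of `p`. Absence of
  -- repetition then yields covering, by `covers`.
  length-entries : (Ms : Matrices p (maxPart p)) → length (entries Ms) ≡ n
  length-entries Ms = trans (length-concat (rows Ms))
    (trans (sum-↭ (map-length-rows-full Ms)) (proj₁ (isPartition p)))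

  entries-▷ : ∀ {k} (Ms : Matrices p k) M → entries (Ms ▷ M) ≡ entries Ms ++ cells M
  entries-▷ Ms M = sym (List.concat-++ (rows Ms) (matrixRows M))

  ∈-remaining : ∀ {k} (Ms : Matrices p k) {x} → x ∈ₛ remaining Ms ⇔ (¬ x ∈ entries Ms)
  ∈-remaining Ms = mk⇔ (λ x∈ → Subset.x∈∁p⇒x∉p x∈ ∘ ∈-fromList⁺)
                       (λ x∉ → Subset.x∉p⇒x∈∁p (x∉ ∘ ∈-fromList⁻ (entries Ms)))

  -- Each matrix takes its entries from the elements remaining after the earlier ones, so no entry
  -- recurs across matrices.
  valid⇒unique : ∀ {k} (Ms : Matrices p k) → Valid Ms → Unique (entries Ms)
  valid⇒unique []       _ = []
  valid⇒unique (Ms ▷ M) (valid , validM) = subst Unique (sym (entries-▷ Ms M))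
    (Unique.++⁺ (valid⇒unique Ms valid) (ValidMatrix.unique validM)
      (λ { (x∈Ms , x∈M) → Equivalence.to (∈-remaining Ms) (ValidMatrix.available validM x∈M) x∈Ms }))

  valid⇒unique-rows : ∀ {k} (Ms : Matrices p k) → Valid Ms → Unique (rows Ms)
  valid⇒unique-rows Ms valid = disjoint⇒unique (rows-nonEmpty Ms)
    (proj₂ (unique-concat⁻ (rows Ms) (valid⇒unique Ms valid)))

-- Pigeonhole: a subset of size n is the full set.
covers : ∀ {xs : List (Fin n)} → Unique xs → length xs ≡ n → ∀ x → x ∈ xs
covers {xs = xs} xs! len x = ∈-fromList⁻ xs
  (subst (x ∈ₛ_) (sym (Subset.∣p∣≡n⇒p≡⊤ (trans (∣fromList∣ xs!) len))) Subset.∈⊤)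

covers⇒length : ∀ {xs : List (Fin n)} → Unique xs → (∀ x → x ∈ xs) → length xs ≡ n
covers⇒length {n} {xs} xs! all = trans (sym (∣fromList∣ xs!))
  (trans (cong ∣_∣ (Subset.⊆-antisym Subset.⊆⊤ (λ {x} _ → ∈-fromList⁺ (all x)))) (Subset.∣⊤∣≡n n))

-- Outputs and partitioned orders

module _ {p : Partition n} (Ns : Matrices p (maxPart p)) (valid : Valid Ns) where

  entries-cover : ∀ x → x ∈ entries Ns
  entries-cover = covers (valid⇒unique Ns valid) (length-entries Ns)

  represented : BP n
  represented = record
    { blocks   = rows Ns
    ; nonEmpty = rows-nonEmpty Ns
    ; distinct = proj₁ (unique-concat⁻ (rows Ns) (valid⇒unique Ns valid))
    ; disjoint = proj₂ (unique-concat⁻ (rows Ns) (valid⇒unique Ns valid))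
    ; covering = λ x → let b , x∈b , b∈ = ∈.∈-concat⁻′ (rows Ns) (entries-cover x) in b , b∈ , x∈b
    }

  represents : (P : BP n) → rows Ns ∼[ set ] BP.blocks P → output Ns Represents P
  represents P same = record
    { fullSize   = refl
    ; entryOnce  = λ x → once⇒occursOnce (unique⇒once (valid⇒unique Ns valid) (entries-cover x))
    ; sameBlocks = same
    }

module _ {p : Partition n} where

  -- Validity makes the list of rows strictly increasing when rows are compared by their heads, and
  -- such a list is determined by its members.
  matrix-determined : ∀ {m ℓ X Y} (M M′ : Matrix (Fin n) m (suc ℓ)) → ValidMatrix X M → ValidMatrix Y M′ →
                      matrixRows M ∼[ set ] matrixRows M′ → M ≡ M′
  matrix-determined M M′ valid valid′ same = toList-injective
    (increasing∧set⇒≡ {_≺_ = λ r s → Vec.head r Fin.< Vec.head s} Fin.<-asym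
      (byHead M valid) (byHead M′ valid′)
      (mk⇔ (⊆-rows (Equivalence.to same)) (⊆-rows (Equivalence.from same))))
    where
    byHead : ∀ {m ℓ X} (M : Matrix (Fin n) m (suc ℓ)) → ValidMatrix X M →
             AllPairs (λ r s → Vec.head r Fin.< Vec.head s) (Vec.toList M)
    byHead M valid = AllPairs.map⁻
      (subst (AllPairs Fin._<_) (Vec.toList-map Vec.head M) (ValidMatrix.increasing valid))

    ⊆-rows : ∀ {m ℓ} {M M′ : Matrix (Fin n) m (suc ℓ)} {r} →
             (∀ {b} → b ∈ matrixRows M → b ∈ matrixRows M′) → r ∈ Vec.toList M → r ∈ Vec.toList M′
    ⊆-rows M⊆M′ r∈M with _ , s∈M′ , r≡s ← ∈.∈-map⁻ Vec.toList (M⊆M′ (∈.∈-map⁺ Vec.toList r∈M))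
      rewrite toList-injective r≡s = s∈M′

  -- Rows of the last matrix have length `suc k` and earlier rows at most `k`, so equality of the
  -- row sets splits into equality for the last matrix and for the earlier ones.
  matrices-determined : ∀ {k} (Ms Ms′ : Matrices p k) → Valid Ms → Valid Ms′ →
                        rows Ms ∼[ set ] rows Ms′ → Ms ≡ Ms′
  matrices-determined [] [] _ _ _ = refl
  matrices-determined (Ms ▷ M) (Ms′ ▷ M′) (valid , validM) (valid′ , validM′) same =
    cong₂ _▷_
      (matrices-determined Ms Ms′ valid valid′
        (mk⇔ (short Ms Ms′ M′ (Equivalence.to same ∘ ∈.∈-++⁺ˡ))
             (short Ms′ Ms M (Equivalence.from same ∘ ∈.∈-++⁺ˡ))))
      (matrix-determined M M′ validM validM′
        (mk⇔ (long M Ms′ M′ (Equivalence.to same ∘ ∈.∈-++⁺ʳ (rows Ms)))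
             (long M′ Ms M (Equivalence.from same ∘ ∈.∈-++⁺ʳ (rows Ms′)))))
    where
    short : ∀ {k} (Ms Ms′ : Matrices p k) M′ {b} →
            (b ∈ rows Ms → b ∈ rows (Ms′ ▷ M′)) → b ∈ rows Ms → b ∈ rows Ms′
    short Ms Ms′ M′ f b∈ with ∈.∈-++⁻ (rows Ms′) (f b∈)
    ... | inj₁ b∈Ms′ = b∈Ms′
    ... | inj₂ b∈M′  = contradiction (≤-trans (≤-reflexive (sym (All.lookup (matrixRows-length M′) b∈M′)))
                                              (proj₂ (All.lookup (rows-length Ms) b∈))) 1+n≰n

    long : ∀ {k m} (M : Matrix (Fin n) m (suc k)) (Ms′ : Matrices p k) M′ {b} →
           (b ∈ matrixRows M → b ∈ rows (Ms′ ▷ M′)) → b ∈ matrixRows M → b ∈ matrixRows M′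
    long M Ms′ M′ f b∈ with ∈.∈-++⁻ (rows Ms′) (f b∈)
    ... | inj₂ b∈M′  = b∈M′
    ... | inj₁ b∈Ms′ = contradiction (≤-trans (≤-reflexive (sym (All.lookup (matrixRows-length M) b∈)))
                                              (proj₂ (All.lookup (rows-length Ms′) b∈Ms′))) 1+n≰n

outputs-determined : ∀ {p q : Partition n} (Ms : Matrices p (maxPart p)) (Ns : Matrices q (maxPart q)) →
                     Valid Ms → Valid Ns → rows Ms ∼[ set ] rows Ns → output Ms ≡ output Ns
outputs-determined {n} {p} {q} Ms Ns validMs validNs same = determined p≡q Ms Ns validMs validNs same
  where
  -- The rows are distinct, so equal row sets are permutations of each other and give the same
  -- multiset of lengths.
  p≡q : p ≡ q
  p≡q = ↭⇒≡-partition {p = p} {q} (begin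
    value p              ↭⟨ map-length-rows-full Ms ⟨
    map length (rows Ms) ↭⟨ ↭.map⁺ length (unique∧set⇒↭ (valid⇒unique-rows Ms validMs)
                                            (valid⇒unique-rows Ns validNs) same) ⟩
    map length (rows Ns) ↭⟨ map-length-rows-full Ns ⟩
    value q              ∎)
    where open PermutationReasoning

  -- Taking the equality as an argument allows matching it with `refl`, which gives both lists of
  -- matrices the same type.
  determined : ∀ {p q : Partition n} → p ≡ q →
               (Ms : Matrices p (maxPart p)) (Ns : Matrices q (maxPart q)) →
               Valid Ms → Valid Ns → rows Ms ∼[ set ] rows Ns → output Ms ≡ output Ns
  determined refl Ms Ns validMs validNs same =
    cong output (matrices-determined Ms Ns validMs validNs same)

-- The output representing a given partitioned order

toVectors : ∀ {j} (bs : List (List A)) → All (λ b → length b ≡ j) bs →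
                   ∃ λ (rs : List (Vec A j)) → map Vec.toList rs ≡ bs
toVectors []       []           = [] , refl
toVectors (b ∷ bs) (refl ∷ len) with rs , refl ← toVectors bs len =
  Vec.fromList b ∷ rs , cong (_∷ map Vec.toList rs) (Vec.toList∘fromList b)

-- Sorting by head gives weakly increasing heads; the heads are among the pairwise distinct entries,
-- so the increase is strict.
sorted-matrix : ∀ {ℓ m} (bs : List (List (Fin n))) → All (λ b → length b ≡ suc ℓ) bs →
                length bs ≡ m → Unique (concat bs) →
                ∃ λ (M : Matrix (Fin n) m (suc ℓ)) →
                  matrixRows M ↭ bs × AllPairs Fin._<_ (Vec.toList (heads M))
sorted-matrix {n} {ℓ} bs len refl bs! with rs , refl ← toVectors bs len =
  build (Sort.sort rs) (Sort.sort-↭ rs) (Linked⇒AllPairs Fin.≤-trans (Sort.sort-↗ rs))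
  where
  module Sort = Data.List.Sort (On.decTotalOrder (Fin.≤-decTotalOrder n) (Vec.head {n = ℓ}))

  build : ∀ ss → ss ↭ rs → AllPairs (λ r s → Vec.head r Fin.≤ Vec.head s) ss →
          ∃ λ (M : Matrix (Fin n) (length (map Vec.toList rs)) (suc ℓ)) →
            matrixRows M ↭ map Vec.toList rs × AllPairs Fin._<_ (Vec.toList (heads M))
  build ss ss↭rs ss↗
    -- The required number of rows is turned into `length ss`, the size of `Vec.fromList ss`.
    rewrite sym (trans (↭.↭-length ss↭rs) (sym (List.length-map Vec.toList rs))) =
    M , rows↭ , AllPairs.zipWith (λ { (x≤y , x≢y) → Fin.≤∧≢⇒< x≤y x≢y }) (heads≤ , heads!)
    where
    M : Matrix (Fin n) (length ss) (suc ℓ)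
    M = Vec.fromList ss

    rows↭ : matrixRows M ↭ map Vec.toList rs
    rows↭ rewrite Vec.toList∘fromList ss = ↭.map⁺ Vec.toList ss↭rs

    heads≤ : AllPairs Fin._≤_ (Vec.toList (heads M))
    heads≤ rewrite Vec.toList-map Vec.head M | Vec.toList∘fromList ss = AllPairs.map⁺ ss↗

    heads! : Unique (Vec.toList (heads M))
    heads! = proj₁ (unique-++⁻ _ (unique-resp-↭ (↭-trans (concat-↭ (↭-sym rows↭)) (cells-↭ M)) bs!))

module _ (P : BP n) where
  open BP P

  private
    blocks! : Unique (concat blocks)
    blocks! = Unique.concat⁺ distinct disjoint

    module Sort = Data.List.Sort ≥-decTotalOrder

    blockLengths : List ℕ
    blockLengths = Sort.sort (map length blocks)

    blockLengths-↭ : blockLengths ↭ map length blocks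
    blockLengths-↭ = Sort.sort-↭ (map length blocks)

    sum-blockLengths : sum blockLengths ≡ n
    sum-blockLengths = trans (sum-↭ blockLengths-↭) (trans (sym (length-concat blocks))
      (covers⇒length blocks! λ x → let _ , b∈ , x∈b = covering x in ∈.∈-concat⁺′ x∈b b∈))

    positive : All (_> 0) blockLengths
    positive = ↭.All-resp-↭ (↭-sym blockLengths-↭) (All.map⁺ (All.map 0<length nonEmpty))
      where
      0<length : ∀ {b : List (Fin n)} → b ≢ [] → 0 < length b
      0<length {b = []}    b≢[] = contradiction refl b≢[]
      0<length {b = _ ∷ _} _    = z<s

    p : Partition n
    p = blockLengths ⊢ [ sum-blockLengths , positive , Sort.sort-↗ (map length blocks) ]

    -- Sorting preserves the number of lengths equal to `j`. This supplies the row count demanded by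
    -- the type of the matrix with `j` columns.
    multiplicity-p : ∀ j → length (filter (λ b → length b ≟ j) blocks) ≡ multiplicity p j
    multiplicity-p j = begin
      length (filter (λ b → length b ≟ j) blocks)              ≡⟨ List.length-map length (filter (λ b → length b ≟ j) blocks) ⟨
      length (map length (filter (λ b → length b ≟ j) blocks)) ≡⟨ cong length (filter-map (_≟ j) length blocks) ⟨
      length (filter (_≟ j) (map length blocks))
        ≡⟨ ↭.↭-length (↭.filter-↭ (_≟ j) blockLengths-↭) ⟨
      length (filter (_≟ j) blockLengths) ∎
      where open ≡-Reasoning

    filter-blocks! : ∀ {P : List (Fin n) → Set} (P? : Decidable P) → Unique (concat (filter P? blocks))
    filter-blocks! P? = Unique.concat⁺ (All.filter⁺ P? distinct) (AllPairs.filter⁺ P? disjoint)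

    -- One sorted matrix is appended per block length. All rows so far are a permutation of some of
    -- the blocks, whose entries do not repeat, so the new matrix avoids the earlier entries.
    matrices-upTo : ∀ k → ∃ λ (Ms : Matrices p k) →
                    rows Ms ↭ filter (λ b → length b ≤? k) blocks × Valid Ms
    matrices-upTo zero = [] , ↭-reflexive (sym (List.filter-none (λ b → length b ≤? 0)
      (All.map (λ { {[]} b≢[] _ → b≢[] refl ; {_ ∷ _} _ () }) nonEmpty))) , tt
    matrices-upTo (suc k)
      with Ms , Ms↭ , valid ← matrices-upTo k
         | M , M↭ , increasing ← sorted-matrix (filter (λ b → length b ≟ suc k) blocks)
             (All.all-filter (λ b → length b ≟ suc k) blocks) (multiplicity-p (suc k))
             (filter-blocks! (λ b → length b ≟ suc k)) =
      Ms ▷ M , rows↭ , valid , record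
        { unique     = proj₁ (proj₂ entries!)
        ; available  = λ x∈M → Equivalence.from (∈-remaining Ms) (λ x∈Ms → proj₂ (proj₂ entries!) (x∈Ms , x∈M))
        ; increasing = increasing
        }
      where
      rows↭ : rows (Ms ▷ M) ↭ filter (λ b → length b ≤? suc k) blocks
      rows↭ = ↭-trans (↭.++⁺ Ms↭ M↭) (↭-sym (filter-≤-suc length k blocks))

      entries! : Unique (entries Ms) × Unique (cells M) × Disjoint (entries Ms) (cells M)
      entries! = unique-++⁻ (entries Ms) (subst Unique (entries-▷ Ms M)
        (unique-resp-↭ (concat-↭ (↭-sym rows↭)) (filter-blocks! (λ b → length b ≤? suc k))))

  -- No block is longer than the largest part, so at `maxPart p` the filter keeps every block.
  representative : ∃ λ (p : Partition n) → ∃ λ (Ns : Matrices p (maxPart p)) →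
                   Valid Ns × rows Ns ∼[ set ] blocks
  representative with Ns , Ns↭ , valid ← matrices-upTo (maxPart p) =
    p , Ns , valid , ↭⇒set (↭-trans Ns↭ (↭-reflexive (List.filter-all _
      (All.map⁻ (↭.All-resp-↭ blockLengths-↭ (xs≤max 0 blockLengths))))))

theorem1 : ∀ (n : ℕ) → n ≥ 1 → (loops : LoopOrders n) →
    (∀ (P : BP n) → OccursOnce (_Represents P) (EnumBP loops))
    × All (λ M → ∃ λ P → M Represents P) (EnumBP loops)
theorem1 n _ loops = occursOnce , All.map sound (EnumBP-sound loops)
  where
  sound : ∀ {O} → (∃ λ p → Result {p = p} [] O) → ∃ λ P → O Represents P
  sound (_ , result Ns _ valid) =
    represented Ns valid , represents Ns valid (represented Ns valid) (mk⇔ id id)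

  occursOnce : ∀ P → OccursOnce (_Represents P) (EnumBP loops)
  occursOnce P with _ , Ns , valid , same ← representative P =
    -- The one position of `output Ns` is also the one position representing `P`: every output in
    -- the list is valid, and valid outputs with the same set of rows are equal.
    once⇒occursOnce (once-resp-⇔ (All.map matches (EnumBP-sound loops)) (once-EnumBP loops Ns valid))
    where
    matches : ∀ {O} → (∃ λ p → Result {p = p} [] O) → O ≡ output Ns ⇔ O Represents P
    matches (_ , result Ms _ validMs) = mk⇔
      (λ { refl → represents Ns valid P same })
      (λ rep → outputs-determined Ms Ns validMs valid
        (mk⇔ (Equivalence.from same ∘ Equivalence.to (_Represents_.sameBlocks rep))
             (Equivalence.from (_Represents_.sameBlocks rep) ∘ Equivalence.to same)))
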